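{- Let $\sigma$ be a finite signature, $\psi$ a strictly limited complexity measure over $\sigma$, $C$ a nonempty class of structures of $\sigma$, and $H$ a nonempty subset of $H(\sigma)$. If the problem of solvability for the quadruple $(\mathrm{Probl}(\sigma),\mathrm{Tree}(\sigma),H,C)$ is decidable, then the problem of optimization for the triple $(\psi,H,C)$ is decidable.
   Context: Notation: $\omega=\{0,1,2,\dots\}$, $E_2=\{0,1\}$, variables $X=\{x_i:i\in\omega\}$, $X_n=\{x_0,\dots,x_{n-1}\}$; $\alpha^1=\alpha$, $\alpha^0=\neg\alpha$. The signature $\sigma=\{q_0,\dots,q_m\}$ (predicate and function symbols with arities, containing predicate symbols); $\sigma^*$ is the set of finite words over $\sigma$ including the empty word $\lambda$. A complexity measure is $\psi:\sigma^*\to\omega$; it is strictly limited if computable and $\psi(\alpha_1\alpha_2\alpha_3)>\psi(\alpha_1\alpha_3)$ whenever $\alpha_2\ne\lambda$. A function expression is $x_j\Leftarrow f(x_{l_1},\dots,x_{l_m})$; an (equality-free) predicate expression is $r(x_{l_1},\dots,x_{l_k})$. For $n\ge1$ and a sequence $\beta=\beta_1,\dots,\beta_m$ define term sequences $M_i=(t_{i0},t_{i1},\dots)$: $M_1=(x_0,\dots,x_{n-1},x_{n-1},\dots)$; $M_{i+1}=M_i$ if $\beta_i$ is a predicate expression; if $\beta_i$ is $x_j\Leftarrow f(x_{l_1},\dots,x_{l_m})$, $M_{i+1}$ is $M_i$ with $t_{ij}$ replaced by $f(t_{il_1},\dots,t_{il_m})$. For predicate $\beta_i=r(x_{l_1},\dots,x_{l_k})$,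 $\kappa(n,\beta,\beta_i)=r(t_{il_1},\dots,t_{il_k})$. $\mathrm{word}(\beta)=q_{i_1}\cdots q_{i_m}$ where $q_{i_j}$ is the symbol in $\beta_j$. $\mathrm{Tree}(\sigma)$: schemes $S=(n,G)$, $n\ge1$, $G$ a finite rooted directed tree with function nodes (function expression, one outgoing edge), predicate nodes (equality-free predicate expression, two outgoing edges labeled $0,1$), terminal nodes (labeled by numbers in $\omega$). For a complete path $\tau=w_1,d_1,\dots,w_m,d_m,w_{m+1}$ with expressions $\beta_\tau=\beta_1,\dots,\beta_m$, $F(\tau)$ is the set of $\kappa(n,\beta_\tau,\beta_i)^c$ for predicate nodes $w_i$, $c$ the label of $d_i$ (a tautology if none), $t_\tau$ the terminal label. For a structure $U$ with universe $A$, $\varphi_{(S,U)}(\bar a)=t_\tau$ for the unique complete path $\tau$ with all of $F(\tau)$ true in $U$ on $\bar a\in A^n$. $\psi(S)=\max_\tau\psi(\mathrm{word}(\beta_\tau))$ over complete paths. $\mathrm{Probl}(\sigma)$: schemes $s=(n,\nu,\beta_1,\dots,\beta_m)$, $n,m\ge1$, equality-free expressions with exactly $k\ge1$ predicate expressions $\beta_{i_1},\dots,\beta_{i_k}$, $\nu:E_2^k\to\omega$; with $\alpha_j=\kappa(n,\beta,\beta_{i_j})$, $\varphi_{(s,U)}(\bar a)=\nu(\alpha_1(\bar a),\dots,\alpha_k(\bar a))$. $S=(n_1,G)$ solves $s=(n_2,\dots)$ relative to class $C$ if $n_1=n_2$ and either $C=\emptyset$ or $\varphi_{(S,U)}=\varphi_{(s,U)}$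 for all $U\in C$. $H(\sigma)$: equality-free sentences of $\sigma$; $C(\alpha)=\{U\in C:U\models\alpha\}$. Problem of solvability for $(\mathrm{Probl}(\sigma),\mathrm{Tree}(\sigma),H,C)$: given $\alpha\in H$, $s$, $S$, decide whether $S$ solves $s$ relative to $C(\alpha)$. Problem of optimization for $(\psi,H,C)$: given $\alpha\in H$ and $s\in\mathrm{Probl}(\sigma)$, find $S\in\mathrm{Tree}(\sigma)$ solving $s$ relative to $C(\alpha)$ with minimum $\psi(S)$ among such schemes. Decidable means solvable by an algorithm. -}

module Defs where

open import Data.Nat using (ℕ; zero; suc; _≤_; _<_; _⊓_; _⊔_; _≡ᵇ_)
open import Data.Fin using (Fin)
open import Data.Bool using (Bool; true; false; if_then_else_)
open import Data.Vec using (Vec; []; _∷_; toList)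
open import Data.Vec.Relation.Unary.Any using (Any)
open import Data.List using (List; []; _∷_; _++_; map; foldr)
open import Data.Product using (Σ; _×_; proj₁)
open import Data.Sum using (_⊎_)
open import Relation.Nullary using (¬_; Dec)
open import Relation.Binary.PropositionalEquality using (_≡_; _≢_; refl)

data Kind : Set where
  fun  : Kind
  pred : Kind

record Signature : Set where
  field
    m       : ℕ
    kind    : Fin (suc m) → Kind
    arity   : Fin (suc m) → ℕ
    hasPred : Σ (Fin (suc m)) (λ q → kind q ≡ pred)

open Signature public

Sym : Signature → Set
Sym σ = Fin (suc (m σ))

Interp : Set → Kind → ℕ → Set
Interp A fun  k = Vec A k → A
Interp A pred k = Vec A k → Bool

record Structure (σ : Signature) : Set₁ where
  field
    carrier    : Set
    inhabitant : carrier
    interp     : (q : Sym σ) → Interp carrier (kind σ q) (arity σ q)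

open Structure public

funOf : ∀ {A k} (κ : Kind) → κ ≡ fun → Interp A κ k → Vec A k → A
funOf fun refl g = g

relOf : ∀ {A k} (κ : Kind) → κ ≡ pred → Interp A κ k → Vec A k → Bool
relOf pred refl g = g

data Term (σ : Signature) : Set where
  var : ℕ → Term σ
  app : (f : Sym σ) → kind σ f ≡ fun → Vec (Term σ) (arity σ f) → Term σ

module _ {σ : Signature} (U : Structure σ) (env : ℕ → carrier U) where
  evalT  : Term σ → carrier U
  evalTs : ∀ {k} → Vec (Term σ) k → Vec (carrier U) k
  evalT (var i) = env i
  evalT (app f e ts) = funOf (kind σ f) e (interp U f) (evalTs ts)
  evalTs [] = []
  evalTs (t ∷ ts) = evalT t ∷ evalTs ts

  evalAtom : (r : Sym σ) → kind σ r ≡ pred → Vec (Term σ) (arity σ r) → Bool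
  evalAtom r e ts = relOf (kind σ r) e (interp U r) (evalTs ts)

data Formula (σ : Signature) : Set where
  atom      : (r : Sym σ) → kind σ r ≡ pred → Vec (Term σ) (arity σ r) → Formula σ
  neg       : Formula σ → Formula σ
  and or imp : Formula σ → Formula σ → Formula σ
  all ex    : ℕ → Formula σ → Formula σ

data OccursIn {σ : Signature} (j : ℕ) : Term σ → Set where
  here  : OccursIn j (var j)
  inApp : ∀ {f e ts} → Any (OccursIn j) ts → OccursIn j (app f e ts)

data FreeIn {σ : Signature} (j : ℕ) : Formula σ → Set where
  atomF : ∀ {r e ts} → Any (OccursIn j) ts → FreeIn j (atom r e ts)
  negF  : ∀ {φ} → FreeIn j φ → FreeIn j (neg φ)
  andL  : ∀ {φ χ} → FreeIn j φ → FreeIn j (and φ χ)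
  andR  : ∀ {φ χ} → FreeIn j χ → FreeIn j (and φ χ)
  orL   : ∀ {φ χ} → FreeIn j φ → FreeIn j (or φ χ)
  orR   : ∀ {φ χ} → FreeIn j χ → FreeIn j (or φ χ)
  impL  : ∀ {φ χ} → FreeIn j φ → FreeIn j (imp φ χ)
  impR  : ∀ {φ χ} → FreeIn j χ → FreeIn j (imp φ χ)
  allF  : ∀ {k φ} → k ≢ j → FreeIn j φ → FreeIn j (all k φ)
  exF   : ∀ {k φ} → k ≢ j → FreeIn j φ → FreeIn j (ex k φ)

Sentence : Signature → Set
Sentence σ = Σ (Formula σ) (λ φ → ∀ j → ¬ FreeIn j φ)

update : {A : Set} → (ℕ → A) → ℕ → A → ℕ → A
update env k a i = if i ≡ᵇ k then a else env i

Sat : {σ : Signature} (U : Structure σ) → (ℕ → carrier U) → Formula σ → Set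
Sat U env (atom r e ts) = evalAtom U env r e ts ≡ true
Sat U env (neg φ)   = ¬ Sat U env φ
Sat U env (and φ χ) = Sat U env φ × Sat U env χ
Sat U env (or φ χ)  = Sat U env φ ⊎ Sat U env χ
Sat U env (imp φ χ) = Sat U env φ → Sat U env χ
Sat U env (all k φ) = (a : carrier U) → Sat U (update env k a) φ
Sat U env (ex k φ)  = Σ (carrier U) (λ a → Sat U (update env k a) φ)

-- sentences have no free variables, so any assignment may be used
_⊨_ : {σ : Signature} → Structure σ → Sentence σ → Set
U ⊨ α = Sat U (λ _ → inhabitant U) (proj₁ α)

record FExpr (σ : Signature) : Set where
  constructor _⇐_∣_∣_
  field
    target : ℕ
    fsym   : Sym σ
    isFun  : kind σ fsym ≡ fun
    fargs  : Vec ℕ (arity σ fsym)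

record PExpr (σ : Signature) : Set where
  constructor _∣_∣_
  field
    psym   : Sym σ
    isPred : kind σ psym ≡ pred
    pargs  : Vec ℕ (arity σ psym)

data Expr (σ : Signature) : Set where
  fe : FExpr σ → Expr σ
  pe : PExpr σ → Expr σ

symbolOf : {σ : Signature} → Expr σ → Sym σ
symbolOf (fe x) = FExpr.fsym x
symbolOf (pe x) = PExpr.psym x

word : {σ : Signature} → List (Expr σ) → List (Sym σ)
word = map symbolOf

TermSeq : Signature → Set
TermSeq σ = ℕ → Term σ

M₁ : {σ : Signature} → ℕ → TermSeq σ
M₁ n' i = var (i ⊓ n')

mapV : ∀ {A B : Set} {k} → (A → B) → Vec A k → Vec B k
mapV f [] = []
mapV f (x ∷ xs) = f x ∷ mapV f xs

stepF : {σ : Signature} → TermSeq σ → FExpr σ → TermSeq σ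
stepF M (j ⇐ f ∣ e ∣ ls) i = if i ≡ᵇ j then app f e (mapV M ls) else M i

stepE : {σ : Signature} → TermSeq σ → Expr σ → TermSeq σ
stepE M (fe x) = stepF M x
stepE M (pe x) = M

κ : {σ : Signature} → TermSeq σ → PExpr σ → Formula σ
κ M (r ∣ e ∣ ls) = atom r e (mapV M ls)

-- assignment given by ā ∈ A^n : x_i ↦ a_i (i < n), x_i ↦ a_{n-1} (i ≥ n)
vecEnv : ∀ {A : Set} {n'} → Vec A (suc n') → ℕ → A
vecEnv (a ∷ []) _ = a
vecEnv (a ∷ b ∷ as) zero = a
vecEnv (a ∷ b ∷ as) (suc i) = vecEnv (b ∷ as) i

κval : {σ : Signature} (U : Structure σ) → (ℕ → carrier U) → TermSeq σ → PExpr σ → Bool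
κval U env M (r ∣ e ∣ ls) = evalAtom U env r e (mapV M ls)

data Tree (σ : Signature) : Set where
  leaf  : ℕ → Tree σ
  fnode : FExpr σ → Tree σ → Tree σ
  pnode : PExpr σ → Tree σ → Tree σ → Tree σ   -- predicate node; edges 0, 1

record TreeScheme (σ : Signature) : Set where
  field
    n'   : ℕ        -- n = suc n' ≥ 1
    tree : Tree σ

runTree : {σ : Signature} (U : Structure σ) → (ℕ → carrier U) → TermSeq σ → Tree σ → ℕ
runTree U env M (leaf c) = c
runTree U env M (fnode x t) = runTree U env (stepF M x) t
runTree U env M (pnode x t₀ t₁) =
  if κval U env M x then runTree U env M t₁ else runTree U env M t₀

φTree : {σ : Signature} (S : TreeScheme σ) (U : Structure σ) →
        Vec (carrier U) (suc (TreeScheme.n' S)) → ℕ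
φTree S U ā = runTree U (vecEnv ā) (M₁ (TreeScheme.n' S)) (TreeScheme.tree S)

pathWords : {σ : Signature} → Tree σ → List (List (Sym σ))
pathWords (leaf c) = [] ∷ []
pathWords (fnode x t) = map (FExpr.fsym x ∷_) (pathWords t)
pathWords (pnode x t₀ t₁) = map (PExpr.psym x ∷_) (pathWords t₀ ++ pathWords t₁)

complexity : {σ : Signature} → (List (Sym σ) → ℕ) → TreeScheme σ → ℕ
complexity ψ S = foldr _⊔_ 0 (map ψ (pathWords (TreeScheme.tree S)))

npreds : {σ : Signature} → List (Expr σ) → ℕ
npreds [] = 0
npreds (fe x ∷ es) = npreds es
npreds (pe x ∷ es) = suc (npreds es)

record ProblScheme (σ : Signature) : Set where
  field
    n'    : ℕ                      -- n = suc n' ≥ 1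
    exprs : List (Expr σ)
    kpos  : 1 ≤ npreds exprs
    ν     : Vec Bool (npreds exprs) → ℕ

predVals : {σ : Signature} (U : Structure σ) → (ℕ → carrier U) → TermSeq σ →
           (es : List (Expr σ)) → Vec Bool (npreds es)
predVals U env M [] = []
predVals U env M (fe x ∷ es) = predVals U env (stepF M x) es
predVals U env M (pe x ∷ es) = κval U env M x ∷ predVals U env M es

φProbl : {σ : Signature} (s : ProblScheme σ) (U : Structure σ) →
         Vec (carrier U) (suc (ProblScheme.n' s)) → ℕ
φProbl s U ā = ProblScheme.ν s
  (predVals U (vecEnv ā) (M₁ (ProblScheme.n' s)) (ProblScheme.exprs s))

-- S solves s relative to the class C(α) = {U ∈ C : U ⊨ α}
-- (if C(α) = ∅ the second component holds vacuously)
SolvesRel : {σ : Signature} → (Structure σ → Set₁) → Sentence σ →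
            TreeScheme σ → ProblScheme σ → Set₁
SolvesRel {σ} C α S s =
  TreeScheme.n' S ≡ ProblScheme.n' s ×
  ((U : Structure σ) → C U → U ⊨ α →
   (ā : Vec (carrier U) (suc (TreeScheme.n' S)))
   (b̄ : Vec (carrier U) (suc (ProblScheme.n' s))) →
   toList ā ≡ toList b̄ → φTree S U ā ≡ φProbl s U b̄)

-- strictly limited (computability is automatic for Agda functions)
StrictlyLimited : {σ : Signature} → (List (Sym σ) → ℕ) → Set
StrictlyLimited ψ = ∀ a₁ a₂ a₃ → a₂ ≢ [] → ψ (a₁ ++ a₃) < ψ (a₁ ++ a₂ ++ a₃)

SolvabilityDecidable : (σ : Signature) → (Structure σ → Set₁) → (Sentence σ → Set) → Set₁
SolvabilityDecidable σ C H =
  (α : Sentence σ) → .(H α) → (s : ProblScheme σ) (S : TreeScheme σ) →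
  Dec (SolvesRel C α S s)

OptimizationDecidable : (σ : Signature) → (List (Sym σ) → ℕ) →
                        (Structure σ → Set₁) → (Sentence σ → Set) → Set₁
OptimizationDecidable σ ψ C H =
  Σ ((α : Sentence σ) → .(H α) → ProblScheme σ → TreeScheme σ) λ opt →
    (α : Sentence σ) (h : H α) (s : ProblScheme σ) →
    SolvesRel C α (opt α h s) s ×
    ((S : TreeScheme σ) → SolvesRel C α S s → complexity ψ (opt α h s) ≤ complexity ψ S)

{-# OPTIONS --safe #-}

-- A tree solving s relative to C(α) can be searched for among finitely many
-- candidates. The canonical tree of s, which tests the predicate expressions
-- of s one after another and outputs ν, solves s relative to every class;
-- let D be its complexity. A competitor of smaller complexity has depth
-- below D, since a strictly limited ψ satisfies length w ≤ ψ w.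
-- Renaming the variables written by its function nodes to fresh indices
-- n, n + 1, … and replacing every terminal label c by c ⊓ K, where K bounds
-- the values of ν, preserves its complexity and its behaviour on C(α).
-- The result lies in the finite list of trees of depth ≤ D over the
-- variables x₀ … x_{n+D-1} with labels ≤ K, so the decidability of
-- solvability lets us take a solving candidate of minimal complexity.

module Submission where

open import Defs
open import Data.Nat using (ℕ)
open import Data.List using (List)
open import Data.Product using (Σ)

open import Data.Nat using (zero; suc; _≤_; _<_; _+_; _⊓_; _⊔_; _≡ᵇ_; _≤?_; z≤n; s≤s; z<s)
open import Data.Nat.Properties
open import Data.Bool using (Bool; true; false)
open import Data.Bool.Properties using (if-float)
open import Data.List using (allFin)
open import Data.Vec using (Vec; []; _∷_; toList)
open import Data.Vec.Properties using (toList-injective; cast-is-id)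
open import Data.Vec.Relation.Unary.All as All using (All; []; _∷_)
open import Data.List using ([]; _∷_; [_]; _++_; map; foldr; filter; concatMap; cartesianProductWith; upTo; length)
open import Data.List.Relation.Unary.Any using (here; there)
open import Data.List.Relation.Unary.All.Properties using (all-filter)
import Data.List.Relation.Unary.All as ListAll
open import Data.List.Membership.Propositional using (_∈_; lose)
open import Data.List.Membership.Propositional.Properties
  using (∈-map⁺; ∈-++⁺ˡ; ∈-++⁺ʳ; ∈-concatMap⁺; ∈-cartesianProductWith⁺; ∈-upTo⁺; ∈-allFin; ∈-filter⁺)
open import Data.List.Extrema.Nat using (argmin; argmin-all; f[argmin]≤f[⊤]; f[argmin]≤f[xs])
open import Data.Product using (∃-syntax; _,_; _×_)
open import Data.Sum using (inj₁; inj₂)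
open import Function using (_∘_)
open import Relation.Nullary using (Dec; yes; no; contradiction)
open import Relation.Unary using (Decidable)
open import Relation.Binary.Definitions using (DecidableEquality)
open import Relation.Binary.PropositionalEquality using (_≡_; refl; sym; trans; cong; cong₂; subst; module ≡-Reasoning)
open import Axiom.UniquenessOfIdentityProofs using (module Decidable⇒UIP)

≤-foldr-⊔ : ∀ {x xs} → x ∈ xs → x ≤ foldr _⊔_ 0 xs
≤-foldr-⊔ {xs = x ∷ xs} (here refl) = m≤m⊔n x _
≤-foldr-⊔ {xs = y ∷ xs} (there x∈xs) = ≤-trans (≤-foldr-⊔ x∈xs) (m≤n⊔m y _)

vectors : {A : Set} → List A → (k : ℕ) → List (Vec A k)
vectors xs zero = [ [] ]
vectors xs (suc k) = cartesianProductWith _∷_ xs (vectors xs k)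

∈-vectors⁺ : ∀ {A : Set} {xs : List A} {k} {v : Vec A k} → All (_∈ xs) v → v ∈ vectors xs k
∈-vectors⁺ [] = here refl
∈-vectors⁺ (x∈xs ∷ v∈xs) = ∈-cartesianProductWith⁺ _∷_ x∈xs (∈-vectors⁺ v∈xs)

toList-injective-≡ : ∀ {A : Set} {n} (xs ys : Vec A n) → toList xs ≡ toList ys → xs ≡ ys
toList-injective-≡ xs ys eq = trans (sym (cast-is-id refl xs)) (toList-injective refl xs ys eq)

mapV-fusion : ∀ {A B C : Set} {k} {g : B → C} {h : A → B} {f : A → C} →
              (∀ x → g (h x) ≡ f x) → (xs : Vec A k) → mapV g (mapV h xs) ≡ mapV f xs
mapV-fusion gh≗f [] = refl
mapV-fusion gh≗f (x ∷ xs) = cong₂ _∷_ (gh≗f x) (mapV-fusion gh≗f xs)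

all-mapV : ∀ {A B : Set} {P : B → Set} {k} {f : A → B} →
           (∀ x → P (f x)) → (xs : Vec A k) → All P (mapV f xs)
all-mapV Pf [] = []
all-mapV Pf (x ∷ xs) = Pf x ∷ all-mapV Pf xs

_≟ᴷ_ : DecidableEquality Kind
fun ≟ᴷ fun = yes refl
fun ≟ᴷ pred = no (λ ())
pred ≟ᴷ fun = no (λ ())
pred ≟ᴷ pred = yes refl

kind-irrelevant : {κ κ′ : Kind} (e e′ : κ ≡ κ′) → e ≡ e′
kind-irrelevant = Decidable⇒UIP.≡-irrelevant _≟ᴷ_

module _ {σ : Signature} where

  scheme : ℕ → Tree σ → TreeScheme σ
  scheme n′ t = record { n' = n′ ; tree = t }

  strictlyLimited⇒length≤ : (ψ : List (Sym σ) → ℕ) → StrictlyLimited {σ} ψ →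
                            ∀ w → length w ≤ ψ w
  strictlyLimited⇒length≤ ψ sl [] = z≤n
  strictlyLimited⇒length≤ ψ sl (a ∷ w) = ≤-trans (s≤s (strictlyLimited⇒length≤ ψ sl w)) (sl [] [ a ] w (λ ()))

  depth : Tree σ → ℕ
  depth (leaf c) = 0
  depth (fnode x t) = suc (depth t)
  depth (pnode x t₀ t₁) = suc (depth t₀ ⊔ depth t₁)

  deepest-path : (t : Tree σ) → ∃[ w ] w ∈ pathWords t × depth t ≤ length w
  deepest-path (leaf c) = [] , here refl , z≤n
  deepest-path (fnode x t) =
    let w , w∈t , d≤w = deepest-path t in
    FExpr.fsym x ∷ w , ∈-map⁺ _ w∈t , s≤s d≤w
  deepest-path (pnode x t₀ t₁) with ⊔-sel (depth t₀) (depth t₁)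
  ... | inj₁ d≡d₀ =
    let w , w∈t₀ , d≤w = deepest-path t₀ in
    PExpr.psym x ∷ w , ∈-map⁺ _ (∈-++⁺ˡ w∈t₀) , s≤s (subst (_≤ length w) (sym d≡d₀) d≤w)
  ... | inj₂ d≡d₁ =
    let w , w∈t₁ , d≤w = deepest-path t₁ in
    PExpr.psym x ∷ w , ∈-map⁺ _ (∈-++⁺ʳ (pathWords t₀) w∈t₁) , s≤s (subst (_≤ length w) (sym d≡d₁) d≤w)

  depth≤complexity : (ψ : List (Sym σ) → ℕ) → StrictlyLimited {σ} ψ →
                     ∀ n′ t → depth t ≤ complexity ψ (scheme n′ t)
  depth≤complexity ψ sl n′ t =
    let w , w∈t , d≤w = deepest-path t in
    ≤-trans d≤w (≤-trans (strictlyLimited⇒length≤ ψ sl w) (≤-foldr-⊔ (∈-map⁺ ψ w∈t)))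

  canonical : (es : List (Expr σ)) → (Vec Bool (npreds es) → ℕ) → Tree σ
  canonical [] ν = leaf (ν [])
  canonical (fe x ∷ es) ν = fnode x (canonical es ν)
  canonical (pe x ∷ es) ν = pnode x (canonical es (ν ∘ (false ∷_))) (canonical es (ν ∘ (true ∷_)))

  runTree-canonical : ∀ U env M (es : List (Expr σ)) ν →
                      runTree U env M (canonical es ν) ≡ ν (predVals U env M es)
  runTree-canonical U env M [] ν = refl
  runTree-canonical U env M (fe x ∷ es) ν = runTree-canonical U env (stepF M x) es ν
  runTree-canonical U env M (pe x ∷ es) ν with κval U env M x
  ... | true = runTree-canonical U env M es (ν ∘ (true ∷_))
  ... | false = runTree-canonical U env M es (ν ∘ (false ∷_))

  canonicalScheme : ProblScheme σ → TreeScheme σ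
  canonicalScheme s = scheme (ProblScheme.n' s) (canonical (ProblScheme.exprs s) (ProblScheme.ν s))

  canonical-solves : ∀ C α s → SolvesRel C α (canonicalScheme s) s
  canonical-solves C α s = refl , λ U _ _ ā b̄ ā≡b̄ →
    trans (runTree-canonical U (vecEnv ā) (M₁ (ProblScheme.n' s)) (ProblScheme.exprs s) (ProblScheme.ν s))
          (cong (φProbl s U) (toList-injective-≡ ā b̄ ā≡b̄))

  labelBound : ProblScheme σ → ℕ
  labelBound s = foldr _⊔_ 0 (map (ProblScheme.ν s) (vectors (false ∷ true ∷ []) _))

  φProbl≤labelBound : ∀ s U ā → φProbl s U ā ≤ labelBound s
  φProbl≤labelBound s U ā = ≤-foldr-⊔ (∈-map⁺ (ProblScheme.ν s) (∈-vectors⁺ (All.universal bool∈ _)))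
    where
    bool∈ : ∀ b → b ∈ false ∷ true ∷ []
    bool∈ false = here refl
    bool∈ true = there (here refl)

  record Simulates (p : ℕ) (ρ : ℕ → ℕ) (M M′ : TermSeq σ) : Set where
    field
      agrees : ∀ i → M′ (ρ i) ≡ M i
      below  : ∀ i → ρ i < p

  Simulates-initial : ∀ n′ → Simulates (suc n′) (_⊓ n′) (M₁ n′) (M₁ n′)
  Simulates-initial n′ = record
    { agrees = λ i → cong var (trans (⊓-assoc i n′ n′) (cong (i ⊓_) (⊓-idem n′)))
    ; below  = λ i → s≤s (m⊓n≤n i n′)
    }

  update-below : ∀ {p ρ} j → (∀ i → ρ i < p) → ∀ i → update ρ j p i < suc p
  update-below j ρ<p i with i ≡ᵇ j
  ... | true = n<1+n _
  ... | false = m<n⇒m<1+n (ρ<p i)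

  -- Since ρ i < p, writing to the fresh index p overwrites no entry through which M′ simulates M.
  Simulates-step : ∀ {p ρ M M′} j f e ls → Simulates p ρ M M′ →
                   Simulates (suc p) (update ρ j p) (stepF M (j ⇐ f ∣ e ∣ ls))
                                                    (stepF M′ (p ⇐ f ∣ e ∣ mapV ρ ls))
  Simulates-step {p} {ρ} {M} {M′} j f e ls sim = record
    { agrees = agrees′ ; below = update-below j below }
    where
    open Simulates sim
    agrees′ : ∀ i → stepF M′ (p ⇐ f ∣ e ∣ mapV ρ ls) (update ρ j p i) ≡ stepF M (j ⇐ f ∣ e ∣ ls) i
    agrees′ i with i ≡ᵇ j
    ... | true with p ≡ᵇ p | ≡⇒≡ᵇ p p refl
    ...   | true | _ = cong (app f e) (mapV-fusion agrees ls)
    ...   | false | ()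
    agrees′ i | false with ρ i ≡ᵇ p | ≡ᵇ⇒≡ (ρ i) p
    ...   | false | _ = agrees i
    ...   | true | ρi≡p = contradiction (ρi≡p _) (<⇒≢ (below i))

  module _ (g : ℕ → ℕ) where

    normalise : (p : ℕ) (ρ : ℕ → ℕ) → Tree σ → Tree σ
    normalise p ρ (leaf c) = leaf (g c)
    normalise p ρ (fnode (j ⇐ f ∣ e ∣ ls) t) =
      fnode (p ⇐ f ∣ e ∣ mapV ρ ls) (normalise (suc p) (update ρ j p) t)
    normalise p ρ (pnode (r ∣ e ∣ ls) t₀ t₁) =
      pnode (r ∣ e ∣ mapV ρ ls) (normalise p ρ t₀) (normalise p ρ t₁)

    runTree-normalise : ∀ U env {p ρ M M′} t → Simulates p ρ M M′ →
                        runTree U env M′ (normalise p ρ t) ≡ g (runTree U env M t)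
    runTree-normalise U env (leaf c) sim = refl
    runTree-normalise U env (fnode (j ⇐ f ∣ e ∣ ls) t) sim =
      runTree-normalise U env t (Simulates-step j f e ls sim)
    runTree-normalise U env {ρ = ρ} {M} {M′} (pnode (r ∣ e ∣ ls) t₀ t₁) sim
      rewrite mapV-fusion {g = M′} {ρ} (Simulates.agrees sim) ls
            | runTree-normalise U env t₀ sim
            | runTree-normalise U env t₁ sim
      = sym (if-float g (evalAtom U env r e (mapV M ls)))

    pathWords-normalise : ∀ p ρ t → pathWords (normalise p ρ t) ≡ pathWords t
    pathWords-normalise p ρ (leaf c) = refl
    pathWords-normalise p ρ (fnode (j ⇐ f ∣ e ∣ ls) t) =
      cong (map (f ∷_)) (pathWords-normalise (suc p) (update ρ j p) t)
    pathWords-normalise p ρ (pnode (r ∣ e ∣ ls) t₀ t₁) =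
      cong (map (r ∷_)) (cong₂ _++_ (pathWords-normalise p ρ t₀) (pathWords-normalise p ρ t₁))

  data Bounded (B K : ℕ) : ℕ → Tree σ → Set where
    leaf  : ∀ {d c} → c ≤ K → Bounded B K d (leaf c)
    fnode : ∀ {d j f e ls t} → j < B → All (_< B) ls → Bounded B K d t →
            Bounded B K (suc d) (fnode (j ⇐ f ∣ e ∣ ls) t)
    pnode : ∀ {d r e ls t₀ t₁} → All (_< B) ls → Bounded B K d t₀ → Bounded B K d t₁ →
            Bounded B K (suc d) (pnode (r ∣ e ∣ ls) t₀ t₁)

  normalise-bounded : ∀ {B K p d ρ} g t → (∀ c → g c ≤ K) → (∀ i → ρ i < p) →
                      p + d ≤ B → depth t ≤ d → Bounded B K d (normalise g p ρ t)
  normalise-bounded g (leaf c) g≤K ρ<p p+d≤B d≤ = leaf (g≤K c)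
  normalise-bounded {B} {p = p} {suc d} g (fnode (j ⇐ f ∣ e ∣ ls) t) g≤K ρ<p p+d≤B (s≤s d≤) =
    fnode (≤-trans (m<m+n p z<s) p+d≤B)
          (all-mapV (λ i → <-≤-trans (ρ<p i) (≤-trans (m≤m+n p _) p+d≤B)) ls)
          (normalise-bounded g t g≤K (update-below j ρ<p) (subst (_≤ B) (+-suc p d) p+d≤B) d≤)
  normalise-bounded {p = p} {suc d} g (pnode (r ∣ e ∣ ls) t₀ t₁) g≤K ρ<p p+d≤B (s≤s d≤) =
    pnode (all-mapV (λ i → <-≤-trans (ρ<p i) (≤-trans (m≤m+n p _) p+d≤B)) ls)
          (normalise-bounded g t₀ g≤K ρ<p p+d′≤B (≤-trans (m≤m⊔n _ _) d≤))
          (normalise-bounded g t₁ g≤K ρ<p p+d′≤B (≤-trans (m≤n⊔m _ _) d≤))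
    where
    p+d′≤B = ≤-trans (+-monoʳ-≤ p (n≤1+n d)) p+d≤B

  module _ (B : ℕ) where

    funExprsOf : (q : Sym σ) → Dec (kind σ q ≡ fun) → List (FExpr σ)
    funExprsOf q (yes e) = cartesianProductWith (λ j ls → j ⇐ q ∣ e ∣ ls) (upTo B) (vectors (upTo B) _)
    funExprsOf q (no _) = []

    funExprs : List (FExpr σ)
    funExprs = concatMap (λ q → funExprsOf q (kind σ q ≟ᴷ fun)) (allFin _)

    ∈-funExprs : ∀ {j q e ls} → j < B → All (_< B) ls → (j ⇐ q ∣ e ∣ ls) ∈ funExprs
    ∈-funExprs {q = q} j<B ls<B = ∈-concatMap⁺ _ (lose (∈-allFin q) (∈-funExprsOf (kind σ q ≟ᴷ fun)))
      where
      ∈-funExprsOf : ∀ {e} d → (_ ⇐ q ∣ e ∣ _) ∈ funExprsOf q d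
      ∈-funExprsOf {e} (yes e′) rewrite kind-irrelevant e e′ =
        ∈-cartesianProductWith⁺ _ (∈-upTo⁺ j<B) (∈-vectors⁺ (All.map ∈-upTo⁺ ls<B))
      ∈-funExprsOf {e} (no ¬e) = contradiction e ¬e

    predExprsOf : (q : Sym σ) → Dec (kind σ q ≡ pred) → List (PExpr σ)
    predExprsOf q (yes e) = map (q ∣ e ∣_) (vectors (upTo B) _)
    predExprsOf q (no _) = []

    predExprs : List (PExpr σ)
    predExprs = concatMap (λ q → predExprsOf q (kind σ q ≟ᴷ pred)) (allFin _)

    ∈-predExprs : ∀ {q e ls} → All (_< B) ls → (q ∣ e ∣ ls) ∈ predExprs
    ∈-predExprs {q} ls<B = ∈-concatMap⁺ _ (lose (∈-allFin q) (∈-predExprsOf (kind σ q ≟ᴷ pred)))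
      where
      ∈-predExprsOf : ∀ {e} d → (q ∣ e ∣ _) ∈ predExprsOf q d
      ∈-predExprsOf {e} (yes e′) rewrite kind-irrelevant e e′ =
        ∈-map⁺ _ (∈-vectors⁺ (All.map ∈-upTo⁺ ls<B))
      ∈-predExprsOf {e} (no ¬e) = contradiction e ¬e

    module _ (K : ℕ) where

      leaves : List (Tree σ)
      leaves = map leaf (upTo (suc K))

      trees : ℕ → List (Tree σ)
      trees zero = leaves
      trees (suc d) = leaves ++ cartesianProductWith fnode funExprs (trees d)
                             ++ concatMap (λ x → cartesianProductWith (pnode x) (trees d) (trees d)) predExprs

      ∈-trees : ∀ {d t} → Bounded B K d t → t ∈ trees d
      ∈-trees {zero} (leaf c≤K) = ∈-map⁺ leaf (∈-upTo⁺ (s≤s c≤K))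
      ∈-trees {suc d} (leaf c≤K) = ∈-++⁺ˡ (∈-map⁺ leaf (∈-upTo⁺ (s≤s c≤K)))
      ∈-trees (fnode j<B ls<B t) =
        ∈-++⁺ʳ leaves (∈-++⁺ˡ (∈-cartesianProductWith⁺ fnode (∈-funExprs j<B ls<B) (∈-trees t)))
      ∈-trees (pnode ls<B t₀ t₁) =
        ∈-++⁺ʳ leaves (∈-++⁺ʳ _ (∈-concatMap⁺ _
          (lose (∈-predExprs ls<B) (∈-cartesianProductWith⁺ _ (∈-trees t₀) (∈-trees t₁)))))

module Optimum {σ : Signature} (ψ : List (Sym σ) → ℕ) (sl : StrictlyLimited {σ} ψ)
               (C : Structure σ → Set₁) (α : Sentence σ) (s : ProblScheme σ)
               (solves? : Decidable (λ S → SolvesRel C α S s)) where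

  open ProblScheme s using (n')

  K D : ℕ
  K = labelBound s
  D = complexity ψ (canonicalScheme s)

  normalised : Tree σ → Tree σ
  normalised = normalise (_⊓ K) (suc n') (_⊓ n')

  normalised-solves : ∀ t → SolvesRel C α (scheme n' t) s → SolvesRel C α (scheme n' (normalised t)) s
  normalised-solves t (_ , t-solves) = refl , λ U U∈C U⊨α ā b̄ ā≡b̄ → begin
    runTree U (vecEnv ā) (M₁ n') (normalised t) ≡⟨ runTree-normalise (_⊓ K) U (vecEnv ā) t (Simulates-initial n') ⟩
    φTree (scheme n' t) U ā ⊓ K                 ≡⟨ cong (_⊓ K) (t-solves U U∈C U⊨α ā b̄ ā≡b̄) ⟩
    φProbl s U b̄ ⊓ K                            ≡⟨ m≤n⇒m⊓n≡m (φProbl≤labelBound s U b̄) ⟩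
    φProbl s U b̄                                ∎
    where open ≡-Reasoning

  candidates : List (TreeScheme σ)
  candidates = map (scheme n') (trees (suc n' + D) K D)

  candidates-complete : ∀ S → SolvesRel C α S s → complexity ψ S < D →
                        ∃[ S′ ] S′ ∈ candidates × SolvesRel C α S′ s × complexity ψ S′ ≡ complexity ψ S
  candidates-complete record { tree = t } S-solves@(refl , _) S<D =
    scheme n' (normalised t) ,
    ∈-map⁺ (scheme n') (∈-trees _ K (normalise-bounded (_⊓ K) t (λ c → m⊓n≤n c K)
      (Simulates.below (Simulates-initial {σ} n')) ≤-refl (≤-trans (depth≤complexity ψ sl n' t) (<⇒≤ S<D)))) ,
    normalised-solves t S-solves ,
    cong (foldr _⊔_ 0 ∘ map ψ) (pathWords-normalise (_⊓ K) (suc n') (_⊓ n') t)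

  optimum : TreeScheme σ
  optimum = argmin (complexity ψ) (canonicalScheme s) (filter solves? candidates)

  optimum-solves : SolvesRel C α optimum s
  optimum-solves = argmin-all (complexity ψ) (canonical-solves C α s) (all-filter solves? candidates)

  optimum-minimal : ∀ S → SolvesRel C α S s → complexity ψ optimum ≤ complexity ψ S
  optimum-minimal S S-solves with D ≤? complexity ψ S
  ... | yes D≤S = ≤-trans (f[argmin]≤f[⊤] {f = complexity ψ} (canonicalScheme s) (filter solves? candidates)) D≤S
  ... | no D≰S =
    let S′ , S′∈ , S′-solves , S′≡S = candidates-complete S S-solves (≰⇒> D≰S) in
    subst (complexity ψ optimum ≤_) S′≡S
      (ListAll.lookup (f[argmin]≤f[xs] {f = complexity ψ} (canonicalScheme s) (filter solves? candidates))
                      (∈-filter⁺ solves? S′∈ S′-solves))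

corollary1 : (σ : Signature) (ψ : List (Sym σ) → ℕ) → StrictlyLimited {σ} ψ →
    (C : Structure σ → Set₁) → Σ (Structure σ) C →
    (H : Sentence σ → Set) → Σ (Sentence σ) H →
    SolvabilityDecidable σ C H → OptimizationDecidable σ ψ C H
corollary1 σ ψ sl C _ H _ solvable? =
  (λ α h s → Optimum.optimum ψ sl C α s (solvable? α h s)) ,
  (λ α h s → Optimum.optimum-solves ψ sl C α s (solvable? α h s) ,
             Optimum.optimum-minimal ψ sl C α s (solvable? α h s))
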